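{- Let $G$ be a $(\Delta+1)$-graph and let $H$ be a subgraph of a regular $(\Delta+1)$-graph $H'$ such that $$\Delta(G)+1\ \ge\ \Delta(H')-\Delta(H).$$ Then $\chi_i(G\,\square\, H)\le \Delta(G\,\square\, H)+2$.
   Context: All graphs are finite and simple. An incidence of a graph $G$ is a pair $(v,e)$ with $v\in V(G)$, $e\in E(G)$ and $v\in e$. Two incidences $(v,e)$ and $(u,f)$ are adjacent if $v=u$, or $e=f$, or $vu\in\{e,f\}$. An incidence coloring of $G$ assigns colors to all incidences so that adjacent incidences receive distinct colors. $\chi_i(G)$ is the least number of colors in an incidence coloring of $G$. $\Delta(G)$ denotes the maximum degree. For a positive integer $k$, $G$ is a $(\Delta+k)$-graph if it admits an incidence coloring with at most $\Delta(G)+k$ colors. $G\,\square\,H$ denotes the Cartesian product: vertex set $V(G)\times V(H)$, with $(u,v)\sim(u',v')$ iff ($uu'\in E(G)$ and $v=v'$) or ($u=u'$ and $vv'\in E(H)$). -}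

module Defs where

open import Data.Empty using (⊥-elim)
open import Data.Fin.Base using (Fin; toℕ; fromℕ<; inject₁; zero; combine; funToFin; finToFun)
open import Data.Fin.Properties using (all?; any?; inj⇒≟; *↔×; toℕ-inject₁; toℕ<n; toℕ-fromℕ<; toℕ-injective; finToFun-funToFin; combine-injective; remQuot-combine)
open import Data.List.Base using (List; length; filter; map; allFin)
open import Data.List.Extrema.Nat using (max)
open import Data.Nat.Base using (ℕ; zero; suc; _+_; _*_; _^_; _≤_; _<_; z≤n; s≤s)
open import Data.Nat.Properties using (_<?_)
import Data.Nat.Properties as ℕ
open import Data.Product.Base using (∃; ∃-syntax; _×_; _,_; proj₁; proj₂; uncurry)
open import Data.Product.Function.NonDependent.Propositional using (_×-↔_)
open import Data.Sum.Base using (_⊎_; inj₁; inj₂)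
open import Function.Base using (_∘_)
open import Function.Bundles using (_↔_; Inverse)
open import Function.Construct.Composition using (_↔-∘_)
open import Function.Construct.Symmetry using (↔-sym)
open import Function.Definitions using (Injective)
open import Function.Properties.Inverse using (↔⇒↣)
open import Relation.Binary.Definitions using (Decidable; DecidableEquality; Symmetric)
open import Relation.Binary.PropositionalEquality using (_≡_; _≢_; refl; sym; trans; cong; cong₂; subst; subst₂)
open import Relation.Nullary using (¬_; Dec; yes; no)
open import Relation.Nullary.Decidable using (map′; _×-dec_; _⊎-dec_; _→-dec_; ¬?)

record Graph : Set₁ where
  infix 4 _~_ _~?_
  field
    Vertex : Set
    order  : ℕ
    enum   : Vertex ↔ Fin order
    _~_    : Vertex → Vertex → Set
    _~?_   : Decidable _~_
    ~-sym    : Symmetric _~_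
    ~-irrefl : ∀ {v} → ¬ (v ~ v)

  index : Vertex → Fin order
  index = Inverse.to enum

  vertexAt : Fin order → Vertex
  vertexAt = Inverse.from enum

  _≟_ : DecidableEquality Vertex
  _≟_ = inj⇒≟ (↔⇒↣ enum)

  vertices : List Vertex
  vertices = map vertexAt (allFin order)

  degree : Vertex → ℕ
  degree v = length (filter (v ~?_) vertices)

-- The maximum degree; by convention 0 for the graph without vertices.
Δ : Graph → ℕ
Δ G = max 0 (map degree vertices)
  where open Graph G

Regular : Graph → Set
Regular G = ∃[ d ] ∀ v → degree v ≡ d
  where open Graph G

-- H is a subgraph of K, where the inclusion of vertex sets is an injection.
record _⊆ᴳ_ (H K : Graph) : Set where
  private
    module H = Graph H
    module K = Graph K
  field
    embed     : H.Vertex → K.Vertex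
    injective : Injective _≡_ _≡_ embed
    preserves : ∀ {u v} → u H.~ v → embed u K.~ embed v

infixr 7 _□_

_□_ : Graph → Graph → Graph
G □ H = record
  { Vertex   = G.Vertex × H.Vertex
  ; order    = G.order * H.order
  ; enum     = ↔-sym *↔× ↔-∘ (G.enum ×-↔ H.enum)
  ; _~_      = λ (u , v) (u′ , v′) → (u G.~ u′ × v ≡ v′) ⊎ (u ≡ u′ × v H.~ v′)
  ; _~?_     = λ (u , v) (u′ , v′) → ((u G.~? u′) ×-dec (v H.≟ v′)) ⊎-dec ((u G.≟ u′) ×-dec (v H.~? v′))
  ; ~-sym    = λ { (inj₁ (p , q)) → inj₁ (G.~-sym p , sym q)
                 ; (inj₂ (p , q)) → inj₂ (sym p , H.~-sym q) }
  ; ~-irrefl = λ { (inj₁ (p , _)) → G.~-irrefl p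
                 ; (inj₂ (_ , q)) → H.~-irrefl q }
  }
  where
  module G = Graph G
  module H = Graph H

-- (a , b) ≐ (c , d) says that {a , b} = {c , d} as unordered pairs.
infix 4 _≐_

_≐_ : {A : Set} → A × A → A × A → Set
(a , b) ≐ (c , d) = (a ≡ c × b ≡ d) ⊎ (a ≡ d × b ≡ c)

module Incidences (G : Graph) where
  open Graph G

  -- An edge {a , b} is represented by both (a , b) and (b , a); edges are
  -- compared by _≐_ on their ends.
  record Edge : Set where
    constructor mkEdge
    field
      ends     : Vertex × Vertex
      adjacent : proj₁ ends ~ proj₂ ends

  open Edge public

  infix 4 _∈ᴱ_ _≈ᴱ_ _≈ᴵ_

  _∈ᴱ_ : Vertex → Edge → Set
  v ∈ᴱ e = v ≡ proj₁ (ends e) ⊎ v ≡ proj₂ (ends e)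

  _≈ᴱ_ : Edge → Edge → Set
  e ≈ᴱ f = ends e ≐ ends f

  record Incidence : Set where
    constructor mkIncidence
    field
      vertex : Vertex
      edge   : Edge
      member : vertex ∈ᴱ edge

  open Incidence public

  _≈ᴵ_ : Incidence → Incidence → Set
  i ≈ᴵ j = vertex i ≡ vertex j × edge i ≈ᴱ edge j

  Adjacent : Incidence → Incidence → Set
  Adjacent i j =
      vertex i ≡ vertex j
    ⊎ edge i ≈ᴱ edge j
    ⊎ ((vertex i , vertex j) ≐ ends (edge i) ⊎ (vertex i , vertex j) ≐ ends (edge j))

-- Incidence colorings with at most k colors. As every incidence satisfies the
-- adjacency condition with itself, properness is about distinct incidences.
record IncidenceColoring (G : Graph) (k : ℕ) : Set where
  open Incidences G
  field
    color    : Incidence → Fin k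
    respects : ∀ i j → i ≈ᴵ j → color i ≡ color j
    proper   : ∀ i j → ¬ (i ≈ᴵ j) → Adjacent i j → color i ≢ color j

IsΔ+Graph : ℕ → Graph → Set
IsΔ+Graph k G = IncidenceColoring G (Δ G + k)

IsLeast : (ℕ → Set) → ℕ → Set
IsLeast P k = P k × (∀ m → P m → k ≤ m)

-- The existence of a least number of colors is proved by exhaustive search,
-- starting from the coloring that gives all incidences different colors.
least : {P : ℕ → Set} → (∀ k → Dec (P k)) → ∀ N → P N → ∃ (IsLeast P)
least {P} P? N pN with P? 0
... | yes p0 = 0 , p0 , λ _ _ → z≤n
least {P} P? zero    pN | no ¬p0 = ⊥-elim (¬p0 pN)
least {P} P? (suc N) pN | no ¬p0 with least {P ∘ suc} (P? ∘ suc) N pN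
... | k , pk , k≤ = suc k , pk , λ { zero p0 → ⊥-elim (¬p0 p0) ; (suc m) pm → s≤s (k≤ m pm) }

module Search (G : Graph) where
  open Graph G
  open Incidences G

  ≐-sym : {p q : Vertex × Vertex} → p ≐ q → q ≐ p
  ≐-sym (inj₁ (refl , refl)) = inj₁ (refl , refl)
  ≐-sym (inj₂ (refl , refl)) = inj₂ (refl , refl)

  ≐-trans : {p q r : Vertex × Vertex} → p ≐ q → q ≐ r → p ≐ r
  ≐-trans (inj₁ (refl , refl)) s = s
  ≐-trans (inj₂ (refl , refl)) (inj₁ (refl , refl)) = inj₂ (refl , refl)
  ≐-trans (inj₂ (refl , refl)) (inj₂ (refl , refl)) = inj₁ (refl , refl)

  _≐?_ : Decidable (_≐_ {Vertex})
  (a , b) ≐? (c , d) = ((a ≟ c) ×-dec (b ≟ d)) ⊎-dec ((a ≟ d) ×-dec (b ≟ c))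

  allVertices? : {P : Vertex → Set} → (∀ v → Dec (P v)) → Dec (∀ v → P v)
  allVertices? {P} P? = map′
    (λ h v → subst P (Inverse.strictlyInverseʳ enum v) (h (index v)))
    (λ h a → h (vertexAt a))
    (all? (P? ∘ vertexAt))

  index-injective : ∀ {u v} → index u ≡ index v → u ≡ v
  index-injective {u} {v} eq =
    trans (sym (Inverse.strictlyInverseʳ enum u))
      (trans (cong vertexAt eq) (Inverse.strictlyInverseʳ enum v))

  arc : ∀ u v → u ~ v → Incidence
  arc u v p = mkIncidence u (mkEdge (u , v) p) (inj₁ refl)

  other : Incidence → Vertex
  other (mkIncidence _ (mkEdge (a , b) _) (inj₁ _)) = b
  other (mkIncidence _ (mkEdge (a , b) _) (inj₂ _)) = a

  vertex~other : ∀ i → vertex i ~ other i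
  vertex~other (mkIncidence _ (mkEdge _ p) (inj₁ refl)) = p
  vertex~other (mkIncidence _ (mkEdge _ p) (inj₂ refl)) = ~-sym p

  ends≐ : ∀ i → ends (edge i) ≐ (vertex i , other i)
  ends≐ (mkIncidence _ _ (inj₁ refl)) = inj₁ (refl , refl)
  ends≐ (mkIncidence _ _ (inj₂ refl)) = inj₂ (refl , refl)

  other-cong : ∀ i j → i ≈ᴵ j → other i ≡ other j
  other-cong i j (v≡ , e≈) with ≐-trans (≐-trans (≐-sym (ends≐ i)) e≈) (ends≐ j)
  ... | inj₁ (_ , o≡) = o≡
  ... | inj₂ (p , q) = trans q (trans (sym v≡) p)

  ≈ᴵ-intro : ∀ i j → vertex i ≡ vertex j → other i ≡ other j → i ≈ᴵ j
  ≈ᴵ-intro i j v≡ o≡ = v≡ , ≐-trans (ends≐ i) (≐-trans (inj₁ (v≡ , o≡)) (≐-sym (ends≐ j)))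

  ArcAdjacent : (u v w x : Vertex) → Set
  ArcAdjacent u v w x = u ≡ w ⊎ (u , v) ≐ (w , x) ⊎ ((u , w) ≐ (u , v) ⊎ (u , w) ≐ (w , x))

  arcAdjacent : ∀ i j → Adjacent i j → ArcAdjacent (vertex i) (other i) (vertex j) (other j)
  arcAdjacent i j (inj₁ v≡) = inj₁ v≡
  arcAdjacent i j (inj₂ (inj₁ e≈)) = inj₂ (inj₁ (≐-trans (≐-sym (ends≐ i)) (≐-trans e≈ (ends≐ j))))
  arcAdjacent i j (inj₂ (inj₂ (inj₁ s))) = inj₂ (inj₂ (inj₁ (≐-trans s (ends≐ i))))
  arcAdjacent i j (inj₂ (inj₂ (inj₂ s))) = inj₂ (inj₂ (inj₂ (≐-trans s (ends≐ j))))

  Good : ℕ → (Vertex → Vertex → ℕ) → Set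
  Good k f =
      (∀ u v → u ~ v → f u v < k)
    × (∀ u v w x → u ~ v → w ~ x → ¬ (u ≡ w × v ≡ x) → ArcAdjacent u v w x → f u v ≢ f w x)

  good? : ∀ k f → Dec (Good k f)
  good? k f =
    (allVertices? λ u → allVertices? λ v → (u ~? v) →-dec (f u v <? k))
    ×-dec
    (allVertices? λ u → allVertices? λ v → allVertices? λ w → allVertices? λ x →
      (u ~? v) →-dec ((w ~? x) →-dec (¬? ((u ≟ w) ×-dec (v ≟ x)) →-dec
      (((u ≟ w) ⊎-dec (((u , v) ≐? (w , x)) ⊎-dec (((u , w) ≐? (u , v)) ⊎-dec ((u , w) ≐? (w , x)))))
        →-dec ¬? (f u v ℕ.≟ f w x)))))

  good-cong : ∀ {k f g} → (∀ u v → f u v ≡ g u v) → Good k f → Good k g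
  good-cong {k} f≗g (bound , prop) =
      (λ u v p → subst (_< k) (f≗g u v) (bound u v p))
    , (λ u v w x p q ne adj → subst₂ _≢_ (f≗g u v) (f≗g w x) (prop u v w x p q ne adj))

  good⇒coloring : ∀ {k} f → Good k f → IncidenceColoring G k
  good⇒coloring {k} f (bound , prop) = record
    { color    = col
    ; respects = λ i j i≈j → toℕ-injective
        (trans (col≡ i) (trans (cong₂ f (proj₁ i≈j) (other-cong i j i≈j)) (sym (col≡ j))))
    ; proper   = λ i j i≉j adj c≡ →
        prop (vertex i) (other i) (vertex j) (other j) (vertex~other i) (vertex~other j)
          (λ (v≡ , o≡) → i≉j (≈ᴵ-intro i j v≡ o≡)) (arcAdjacent i j adj)
          (trans (sym (col≡ i)) (trans (cong toℕ c≡) (col≡ j)))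
    }
    where
    col : Incidence → Fin k
    col i = fromℕ< (bound (vertex i) (other i) (vertex~other i))
    col≡ : ∀ i → toℕ (col i) ≡ f (vertex i) (other i)
    col≡ i = toℕ-fromℕ< (bound (vertex i) (other i) (vertex~other i))

  decode : ∀ {k} → Fin (suc k ^ (order * order)) → Vertex → Vertex → ℕ
  decode c u v = toℕ (finToFun c (combine (index u) (index v)))

  module _ {k} (C : IncidenceColoring G k) where
    open IncidenceColoring C

    value : Vertex → Vertex → Fin (suc k)
    value u v with u ~? v
    ... | yes p = inject₁ (color (arc u v p))
    ... | no  _ = zero

    value≡ : ∀ u v (p : u ~ v) → toℕ (value u v) ≡ toℕ (color (arc u v p))
    value≡ u v p with u ~? v
    ... | yes q = trans (toℕ-inject₁ _)
                    (cong toℕ (respects (arc u v q) (arc u v p) (refl , inj₁ (refl , refl))))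
    ... | no ¬q = ⊥-elim (¬q p)

    value-good : Good k (λ u v → toℕ (value u v))
    value-good =
        (λ u v p → subst (_< k) (sym (value≡ u v p)) (toℕ<n _))
      , (λ u v w x p q ne adj c≡ → proper (arc u v p) (arc w x q) (arcs≉ {p = p} {q} ne) adj
          (toℕ-injective (trans (sym (value≡ u v p)) (trans c≡ (value≡ w x q)))))
      where
      arcs≉ : ∀ {u v w x} {p : u ~ v} {q : w ~ x} → ¬ (u ≡ w × v ≡ x) → ¬ (arc u v p ≈ᴵ arc w x q)
      arcs≉ ne (refl , inj₁ (_ , v≡x)) = ne (refl , v≡x)
      arcs≉ ne (refl , inj₂ (u≡x , v≡u)) = ne (refl , trans v≡u u≡x)

    table : Fin (order * order) → Fin (suc k)
    table = uncurry (λ a b → value (vertexAt a) (vertexAt b)) ∘ Inverse.to *↔×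

    value-decode : ∀ u v → toℕ (value u v) ≡ decode (funToFin table) u v
    value-decode u v = sym (cong toℕ (trans (finToFun-funToFin table (combine (index u) (index v)))
      (trans (cong (uncurry λ a b → value (vertexAt a) (vertexAt b)) (remQuot-combine (index u) (index v)))
             (cong₂ value (Inverse.strictlyInverseʳ enum u) (Inverse.strictlyInverseʳ enum v)))))

  coloring? : ∀ k → Dec (IncidenceColoring G k)
  coloring? k = map′
    (λ (c , good) → good⇒coloring (decode {k} c) good)
    (λ C → funToFin (table C) , good-cong {k} (value-decode C) (value-good C))
    (any? λ c → good? k (decode {k} c))

  rainbow : IncidenceColoring G (order * order)
  rainbow = record
    { color    = λ i → combine (index (vertex i)) (index (other i))
    ; respects = λ i j i≈j → cong₂ (λ u v → combine (index u) (index v)) (proj₁ i≈j) (other-cong i j i≈j)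
    ; proper   = λ i j i≉j _ c≡ →
        let (v≡ , o≡) = combine-injective (index (vertex i)) (index (other i)) (index (vertex j)) (index (other j)) c≡
        in i≉j (≈ᴵ-intro i j (index-injective v≡) (index-injective o≡))
    }

leastColors : (G : Graph) → ∃ (IsLeast (IncidenceColoring G))
leastColors G = least (Search.coloring? G) _ (Search.rainbow G)

χᵢ : Graph → ℕ
χᵢ G = proj₁ (leastColors G)

{-# OPTIONS --safe #-}
module Submission where

-- Regard the incidence (u , uv) as the arc u → v: two distinct incidences are
-- adjacent iff their arcs leave the same vertex or form a directed walk.
-- In a d-regular graph colored with d + 1 colors, the arcs leaving a vertex v
-- use d colors, so all arcs entering v carry the single remaining color. For H
-- inside H′ this means that at most Δ(H) + 1 colors occur on the arcs of H
-- incident with v. Hence among Δ(G) + Δ(H) + 2 colors at least Δ(G) + 1 are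
-- free for the copy of G over v, and different copies do not interact. The
-- colors of H′ fit because Δ(H′) ≤ Δ(G) + Δ(H) + 1.

open import Defs
open import Data.Empty using (⊥-elim)
open import Data.Fin.Base using (Fin; zero; suc; inject≤)
open import Data.Fin.Properties as Fin using (inject≤-injective; injective⇒≤)
open import Data.List.Base using (List; _∷_; _++_; length; filter; map; allFin; tabulate; lookup)
open import Data.List.Extrema.Nat using (argmax-sel; xs≤max)
open import Data.List.Membership.Propositional using (_∈_; _∉_)
open import Data.List.Membership.DecPropositional using (_∈?_)
open import Data.List.Membership.Propositional.Properties using (∈-lookup; ∈-allFin; ∈-filter⁺; ∈-filter⁻; ∈-map⁺; ∈-map⁻; ∈-++⁺ˡ; ∈-++⁺ʳ; ∈-++⁻; ∈-tabulate⁺; ∈-tabulate⁻)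
open import Data.List.Properties using (length-++; length-map; length-tabulate)
open import Data.List.Relation.Binary.Subset.Propositional using (_⊆_)
open import Data.List.Relation.Unary.All as All using (_∷_)
open import Data.List.Relation.Unary.All.Properties using (¬Any⇒All¬)
open import Data.List.Relation.Unary.AllPairs.Core using (_∷_)
open import Data.List.Relation.Unary.Any as Any using (here; there)
open import Data.List.Relation.Unary.Any.Properties using (lookup-index)
open import Data.List.Relation.Unary.Unique.Propositional using (Unique)
import Data.List.Relation.Unary.Unique.Propositional.Properties as Unique
open import Data.Nat.Base using (ℕ; zero; suc; _+_; _∸_; _≤_; _≥_; s≤s)
open import Data.Nat.Properties using (≤-trans; ≤-reflexive; +-cancelˡ-≤; +-comm; +-monoˡ-≤; +-monoʳ-≤; m≤n+m∸n; n≤0⇒n≡0; 1+n≰n; module ≤-Reasoning)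
open import Data.Nat.Solver using (module +-*-Solver)
open import Data.Product.Base using (∃-syntax; _×_; _,_; proj₁; proj₂)
open import Data.Sum.Base using (inj₁; inj₂)
open import Function.Base using (id; _∘_)
open import Function.Bundles using (Inverse)
open import Function.Definitions using (Injective)
open import Relation.Binary.PropositionalEquality using (_≡_; _≢_; refl; sym; trans; cong; cong₂; subst; subst₂)
open import Relation.Nullary using (¬_; Dec; yes; no)
open import Relation.Nullary.Decidable using (map′; ¬?)

-- Counting with duplicate-free lists, and choosing free colors.

lookup-injective : ∀ {A : Set} {xs : List A} → Unique xs → Injective _≡_ _≡_ (lookup xs)
lookup-injective (x∉ ∷ _) {zero}  {zero}  eq = refl
lookup-injective (x∉ ∷ _) {zero}  {suc j} eq = ⊥-elim (All.lookup x∉ (∈-lookup j) eq)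
lookup-injective (x∉ ∷ _) {suc i} {zero}  eq = ⊥-elim (All.lookup x∉ (∈-lookup i) (sym eq))
lookup-injective (_ ∷ u)  {suc i} {suc j} eq = cong suc (lookup-injective u eq)

-- Sending each position of `xs` to a position of the same entry in `ys` is injective, because the
-- entry can be read off from its image and `xs` has no repetitions.
Unique-⊆⇒length≤ : ∀ {A : Set} {xs ys : List A} → Unique xs → xs ⊆ ys → length xs ≤ length ys
Unique-⊆⇒length≤ {xs = xs} {ys} u xs⊆ys = injective⇒≤ {f = position} position-injective
  where
  position : Fin (length xs) → Fin (length ys)
  position i = Any.index (xs⊆ys (∈-lookup i))

  position-injective : Injective _≡_ _≡_ position
  position-injective {i} {j} eq = lookup-injective u
    (trans (lookup-index (xs⊆ys (∈-lookup i)))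
      (trans (cong (lookup ys) eq) (sym (lookup-index (xs⊆ys (∈-lookup j))))))

Unique⇒length≤ : ∀ {n} {xs : List (Fin n)} → Unique xs → length xs ≤ n
Unique⇒length≤ {n} u =
  ≤-trans (Unique-⊆⇒length≤ u (λ {x} _ → ∈-allFin x)) (≤-reflexive (length-tabulate {n = n} id))

-- A renaming of `m` colors into colors outside `xs`. With `m` equal to 1 it yields a missing color;
-- in general it moves a coloring of `G` away from the colors that `H` occupies at a vertex.
record Avoiding (m : ℕ) {n : ℕ} (xs : List (Fin n)) : Set where
  field
    choose    : Fin m → Fin n
    injective : Injective _≡_ _≡_ choose
    avoids    : ∀ i → choose i ∉ xs

-- Every color lies in `xs` or in `free`, so at least `n` minus `length xs` colors are free.
-- Repetitions in `xs` do no harm.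
avoiding : ∀ {m n} (xs : List (Fin n)) → m + length xs ≤ n → Avoiding m xs
avoiding {m} {n} xs m+≤n = record
  { choose    = λ i → lookup free (inject≤ i m≤free)
  ; injective = λ {i} {j} eq →
      inject≤-injective m≤free m≤free i j (lookup-injective free-unique eq)
  ; avoids    = λ i → proj₂ (∈-filter⁻ ∉xs? {xs = allFin n} (∈-lookup (inject≤ i m≤free)))
  }
  where
  ∉xs? = λ x → ¬? (_∈?_ Fin._≟_ x xs)

  free : List (Fin n)
  free = filter ∉xs? (allFin n)

  free-unique : Unique free
  free-unique = Unique.filter⁺ ∉xs? (Unique.allFin⁺ n)

  covered : allFin n ⊆ xs ++ free
  covered {x} x∈ with _∈?_ Fin._≟_ x xs
  ... | yes x∈xs = ∈-++⁺ˡ x∈xs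
  ... | no  x∉xs = ∈-++⁺ʳ xs (∈-filter⁺ ∉xs? x∈ x∉xs)

  m≤free : m ≤ length free
  m≤free = +-cancelˡ-≤ (length xs) m (length free) (begin
    length xs + m           ≡⟨ +-comm (length xs) m ⟩
    m + length xs           ≤⟨ m+≤n ⟩
    n                       ≡⟨ length-tabulate {n = n} id ⟨
    length (allFin n)       ≤⟨ Unique-⊆⇒length≤ (Unique.allFin⁺ n) covered ⟩
    length (xs ++ free)     ≡⟨ length-++ xs ⟩
    length xs + length free ∎)
    where open ≤-Reasoning

-- Neighbors, degrees and the maximum degree.

module Degrees (G : Graph) where
  open Graph G
  open Inverse enum using (strictlyInverseˡ; strictlyInverseʳ)

  ∈-vertices : ∀ v → v ∈ vertices
  ∈-vertices v = subst (_∈ vertices) (strictlyInverseʳ v) (∈-map⁺ vertexAt (∈-allFin (index v)))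

  vertices-unique : Unique vertices
  vertices-unique = Unique.map⁺ vertexAt-injective (Unique.allFin⁺ order)
    where
    vertexAt-injective : Injective _≡_ _≡_ vertexAt
    vertexAt-injective {i} {j} eq =
      trans (sym (strictlyInverseˡ i)) (trans (cong index eq) (strictlyInverseˡ j))

  neighbors : Vertex → List Vertex
  neighbors v = filter (v ~?_) vertices

  neighbors-unique : ∀ v → Unique (neighbors v)
  neighbors-unique v = Unique.filter⁺ (v ~?_) vertices-unique

  ∈-neighbors⁺ : ∀ {v w} → v ~ w → w ∈ neighbors v
  ∈-neighbors⁺ {v} {w} = ∈-filter⁺ (v ~?_) (∈-vertices w)

  ∈-neighbors⁻ : ∀ {v w} → w ∈ neighbors v → v ~ w
  ∈-neighbors⁻ {v} = proj₂ ∘ ∈-filter⁻ (v ~?_) {xs = vertices}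

  degree≤Δ : ∀ v → degree v ≤ Δ G
  degree≤Δ v = All.lookup (xs≤max 0 (map degree vertices)) (∈-map⁺ degree (∈-vertices v))

  Δ-attained : Vertex → ∃[ w ] degree w ≡ Δ G
  Δ-attained v with argmax-sel id 0 (map degree vertices)
  -- The maximum is the default value 0, so all degrees vanish and the given vertex attains it.
  ... | inj₁ Δ≡0 = v , trans (n≤0⇒n≡0 (subst (degree v ≤_) Δ≡0 (degree≤Δ v))) (sym Δ≡0)
  ... | inj₂ Δ∈ with ∈-map⁻ degree Δ∈
  ...   | w , _ , Δ≡ = w , sym Δ≡

  regular⇒degree≡Δ : Regular G → ∀ v → degree v ≡ Δ G
  regular⇒degree≡Δ (_ , deg≡) v with Δ-attained v
  ... | w , deg≡Δ = trans (deg≡ v) (trans (sym (deg≡ w)) deg≡Δ)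

-- Degrees in the Cartesian product.

module _ (G H : Graph) where
  private
    module G = Graph G
    module H = Graph H
    module DG = Degrees G
    module DH = Degrees H
    module D□ = Degrees (G □ H)

  degree-□ : ∀ u v → G.degree u + H.degree v ≤ Graph.degree (G □ H) (u , v)
  degree-□ u v = begin
    G.degree u + H.degree v        ≡⟨ cong₂ _+_ (length-map (_, v) (DG.neighbors u)) (length-map (u ,_) (DH.neighbors v)) ⟨
    length left + length right     ≡⟨ length-++ left ⟨
    length (left ++ right)         ≤⟨ Unique-⊆⇒length≤ unique included ⟩
    Graph.degree (G □ H) (u , v)   ∎
    where
    open ≤-Reasoning

    left right : List (G.Vertex × H.Vertex)
    left  = map (_, v) (DG.neighbors u)
    right = map (u ,_) (DH.neighbors v)

    disjoint : ∀ {x} → ¬ (x ∈ left × x ∈ right)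
    disjoint (x∈l , x∈r) with ∈-map⁻ (_, v) x∈l | ∈-map⁻ (u ,_) x∈r
    -- A common entry has first component `u`, which would make `u` a neighbor of itself.
    ... | u′ , u′∈ , refl | v′ , v′∈ , refl = G.~-irrefl (DG.∈-neighbors⁻ u′∈)

    unique : Unique (left ++ right)
    unique = Unique.++⁺ (Unique.map⁺ (cong proj₁) (DG.neighbors-unique u))
                        (Unique.map⁺ (cong proj₂) (DH.neighbors-unique v))
                        disjoint

    included : left ++ right ⊆ D□.neighbors (u , v)
    included x∈ with ∈-++⁻ left x∈
    ... | inj₁ x∈l with ∈-map⁻ (_, v) x∈l
    ...   | u′ , u′∈ , refl = D□.∈-neighbors⁺ (inj₁ (DG.∈-neighbors⁻ u′∈ , refl))
    included x∈ | inj₂ x∈r with ∈-map⁻ (u ,_) x∈r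
    ...   | v′ , v′∈ , refl = D□.∈-neighbors⁺ (inj₂ (refl , DH.∈-neighbors⁻ v′∈))

  -- Pair vertices of maximum degree. Both factors must be inhabited: an empty factor makes the
  -- product empty, with maximum degree 0, whatever the other factor is.
  Δ-□ : G.Vertex → H.Vertex → Δ G + Δ H ≤ Δ (G □ H)
  Δ-□ u v with DG.Δ-attained u | DH.Δ-attained v
  ... | u′ , Δ≡u | v′ , Δ≡v =
    subst₂ (λ a b → a + b ≤ Δ (G □ H)) Δ≡u Δ≡v
      (≤-trans (degree-□ u′ v′) (D□.degree≤Δ (u′ , v′)))

-- Incidence colorings as colorings of arcs.

-- A proof of `u ~ v` stands for the incidence of `u` with the edge `uv`; `irrelevant` is required
-- because such proofs need not be unique. In `through`, the case where `w` is `u` separates the two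
-- incidences of one edge.
record ArcColoring (G : Graph) (n : ℕ) : Set where
  open Graph G
  field
    color         : ∀ {u v} → u ~ v → Fin n
    irrelevant    : ∀ {u v} (p q : u ~ v) → color p ≡ color q
    out-injective : ∀ {u v w} (p : u ~ v) (q : u ~ w) → color p ≡ color q → v ≡ w
    through       : ∀ {u v w} (p : u ~ v) (q : v ~ w) → color p ≢ color q

module _ {G : Graph} {n : ℕ} where
  open Graph G
  open Incidences G
  open Search G

  toArcColoring : IncidenceColoring G n → ArcColoring G n
  toArcColoring C = record
    { color         = λ {u} {v} p → color (arc u v p)
    ; irrelevant    = λ {u} {v} p q → respects (arc u v p) (arc u v q) (refl , inj₁ (refl , refl))
    ; out-injective = out-injective′
    ; through       = λ {u} {v} {w} p q → proper (arc u v p) (arc v w q)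
        (λ { (refl , _) → ~-irrefl p }) (inj₂ (inj₂ (inj₁ (inj₁ (refl , refl)))))
    }
    where
    open IncidenceColoring C

    out-injective′ : ∀ {u v w} (p : u ~ v) (q : u ~ w) →
                     color (arc u v p) ≡ color (arc u w q) → v ≡ w
    out-injective′ {u} {v} {w} p q eq with v ≟ w
    ... | yes v≡w = v≡w
    ... | no  v≢w = ⊥-elim (proper (arc u v p) (arc u w q)
      (λ e → v≢w (other-cong (arc u v p) (arc u w q) e)) (inj₁ refl) eq)

  toIncidenceColoring : ArcColoring G n → IncidenceColoring G n
  toIncidenceColoring C = record
    { color    = λ i → color (vertex~other i)
    ; respects = λ i j i≈j →
        congruent (proj₁ i≈j) (other-cong i j i≈j) (vertex~other i) (vertex~other j)
    ; proper   = λ i j i≉j adj → distinct (vertex~other i) (vertex~other j)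
        (λ (v≡ , o≡) → i≉j (≈ᴵ-intro i j v≡ o≡)) (arcAdjacent i j adj)
    }
    where
    open ArcColoring C

    congruent : ∀ {u v w x} → u ≡ w → v ≡ x → (p : u ~ v) (q : w ~ x) → color p ≡ color q
    congruent refl refl = irrelevant

    -- Apart from a common tail, each kind of adjacency gives opposite arcs, a directed walk in one
    -- of the two orders, or an impossible case: equal arcs or a loop.
    distinct : ∀ {u v w x} (p : u ~ v) (q : w ~ x) → ¬ (u ≡ w × v ≡ x) →
               ArcAdjacent u v w x → color p ≢ color q
    distinct p q ne (inj₁ refl) eq = ne (refl , out-injective p q eq)
    distinct p q ne (inj₂ (inj₁ (inj₁ same))) = ⊥-elim (ne same)
    distinct p q ne (inj₂ (inj₁ (inj₂ (refl , refl)))) = through p q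
    distinct p q ne (inj₂ (inj₂ (inj₁ (inj₁ (_ , refl))))) = through p q
    distinct p q ne (inj₂ (inj₂ (inj₁ (inj₂ (refl , _))))) = ⊥-elim (~-irrefl p)
    distinct p q ne (inj₂ (inj₂ (inj₂ (inj₁ (_ , refl))))) = ⊥-elim (~-irrefl q)
    distinct p q ne (inj₂ (inj₂ (inj₂ (inj₂ (refl , _))))) = through q p ∘ sym

-- Colors leaving and entering a vertex.

module OutColors {G : Graph} {n : ℕ} (C : ArcColoring G n) where
  open Graph G
  open Degrees G
  open ArcColoring C

  outArc : ∀ v i → v ~ lookup (neighbors v) i
  outArc v i = ∈-neighbors⁻ (∈-lookup i)

  -- Tabulated over positions in `neighbors v`, since a color can only be read off from a proof of
  -- adjacency, which a position supplies.
  outColors : Vertex → List (Fin n)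
  outColors v = tabulate (λ i → color (outArc v i))

  length-outColors : ∀ v → length (outColors v) ≡ degree v
  length-outColors v = length-tabulate (λ i → color (outArc v i))

  outColors-unique : ∀ v → Unique (outColors v)
  outColors-unique v = Unique.tabulate⁺ λ {i} {j} eq →
    lookup-injective (neighbors-unique v) (out-injective (outArc v i) (outArc v j) eq)

  ∈-outColors : ∀ {v w} (p : v ~ w) → color p ∈ outColors v
  ∈-outColors {v} {w} p = subst (_∈ outColors v) (sym (same (lookup-index w∈))) (∈-tabulate⁺ (Any.index w∈))
    where
    w∈ : w ∈ neighbors v
    w∈ = ∈-neighbors⁺ p
    same : ∀ {x} {q : v ~ x} → w ≡ x → color p ≡ color q
    same {q = q} refl = irrelevant p q

  inColor∉outColors : ∀ {v w} (p : w ~ v) → color p ∉ outColors v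
  inColor∉outColors {v} p p∈ with ∈-tabulate⁻ p∈
  ... | i , eq = through p (outArc v i) eq

-- This is the property that passes from `H′` to `H`: it survives deletion of arcs and enlargement
-- of the palette, whereas having degree one less than the number of colors does not.
InMonochromatic : ∀ {G n} → ArcColoring G n → Set
InMonochromatic {G} {n} C = ∀ v → ∃[ s ] ∀ {w} (p : w ~ v) → color p ≡ s
  where
  open Graph G
  open ArcColoring C

saturated⇒inMonochromatic : ∀ {G n} (C : ArcColoring G n) →
  (∀ v → Graph.degree G v + 1 ≡ n) → InMonochromatic C
saturated⇒inMonochromatic {G} {n} C degree+1≡n v = missing , inColor≡missing
  where
  open Graph G
  open ArcColoring C
  open OutColors C

  1+length≡n : 1 + length (outColors v) ≡ n
  1+length≡n = trans (cong suc (length-outColors v)) (trans (+-comm 1 (degree v)) (degree+1≡n v))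

  open Avoiding (avoiding {1} (outColors v) (≤-reflexive 1+length≡n))

  missing : Fin n
  missing = choose zero

  inColor≡missing : ∀ {w} (p : w ~ v) → color p ≡ missing
  inColor≡missing p with color p Fin.≟ missing
  ... | yes eq = eq
  -- Otherwise the entering color, `missing` and the out-colors would be `n + 1` distinct elements
  -- of `Fin n`.
  ... | no  ne = ⊥-elim (1+n≰n (≤-trans (s≤s (≤-reflexive (sym 1+length≡n)))
    (Unique⇒length≤ ((ne ∷ ¬Any⇒All¬ _ (inColor∉outColors p))
                     ∷ ¬Any⇒All¬ _ (avoids zero) ∷ outColors-unique v))))

-- Passing to subgraphs and to larger palettes.

restrict : ∀ {H K m} → H ⊆ᴳ K → ArcColoring K m → ArcColoring H m
restrict H⊆K C = record
  { color         = λ p → color (preserves p)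
  ; irrelevant    = λ p q → irrelevant (preserves p) (preserves q)
  ; out-injective = λ p q eq → injective (out-injective (preserves p) (preserves q) eq)
  ; through       = λ p q → through (preserves p) (preserves q)
  }
  where
  open _⊆ᴳ_ H⊆K
  open ArcColoring C

restrict-inMonochromatic : ∀ {H K m} (H⊆K : H ⊆ᴳ K) {C : ArcColoring K m} →
  InMonochromatic C → InMonochromatic (restrict H⊆K C)
restrict-inMonochromatic H⊆K mono v =
  proj₁ (mono (embed v)) , λ p → proj₂ (mono (embed v)) (preserves p)
  where open _⊆ᴳ_ H⊆K

weaken : ∀ {G m n} → m ≤ n → ArcColoring G m → ArcColoring G n
weaken m≤n C = record
  { color         = λ p → inject≤ (color p) m≤n
  ; irrelevant    = λ p q → cong (λ c → inject≤ c m≤n) (irrelevant p q)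
  ; out-injective = λ p q eq → out-injective p q (inject≤-injective m≤n m≤n _ _ eq)
  ; through       = λ p q eq → through p q (inject≤-injective m≤n m≤n _ _ eq)
  }
  where open ArcColoring C

weaken-inMonochromatic : ∀ {G m n} (m≤n : m ≤ n) {C : ArcColoring G m} →
  InMonochromatic C → InMonochromatic (weaken m≤n C)
weaken-inMonochromatic m≤n mono v =
  inject≤ (proj₁ (mono v)) m≤n , λ p → cong (λ c → inject≤ c m≤n) (proj₂ (mono v) p)

-- Coloring the product.

-- Arcs along `H` keep their color under `D`; arcs along `G` in the copy over `v` take their color
-- under `C`, renamed by a palette depending on `v`. The summand `suc (Δ H)` bounds the one entering
-- color together with the out-colors at `v`.
□-coloring : ∀ {G H m n} → ArcColoring G m → (D : ArcColoring H n) → InMonochromatic D →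
  m + suc (Δ H) ≤ n → ArcColoring (G □ H) n
□-coloring {G} {H} {m} {n} C D mono m+1+Δ≤n = record
  { color         = color
  ; irrelevant    = irrelevant
  ; out-injective = out-injective
  ; through       = through
  }
  where
  module G = Graph G
  module H = Graph H
  module C = ArcColoring C
  module D = ArcColoring D
  open Graph (G □ H) using (_~_)
  open OutColors D

  forbidden : H.Vertex → List (Fin n)
  forbidden v = proj₁ (mono v) ∷ outColors v

  palette : ∀ v → Avoiding m (forbidden v)
  palette v = avoiding (forbidden v) (≤-trans
    (+-monoʳ-≤ m (s≤s (≤-trans (≤-reflexive (length-outColors v)) (Degrees.degree≤Δ H v))))
    m+1+Δ≤n)

  module P v = Avoiding (palette v)

  color : ∀ {x y} → x ~ y → Fin n
  color {_ , v} (inj₁ (p , _)) = P.choose v (C.color p)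
  color         (inj₂ (_ , q)) = D.color q

  choose≢out : ∀ {v w} i (q : v H.~ w) → P.choose v i ≢ D.color q
  choose≢out {v} i q eq = P.avoids v i (there (subst (_∈ outColors v) (sym eq) (∈-outColors q)))

  in≢choose : ∀ {v w} (q : w H.~ v) i → D.color q ≢ P.choose v i
  in≢choose {v} q i eq = P.avoids v i (here (trans (sym eq) (proj₂ (mono v) q)))

  irrelevant : ∀ {x y} (p q : x ~ y) → color p ≡ color q
  irrelevant (inj₁ (p , refl)) (inj₁ (q , _)) = cong (P.choose _) (C.irrelevant p q)
  irrelevant (inj₁ (p , refl)) (inj₂ (_ , q)) = ⊥-elim (H.~-irrefl q)
  irrelevant (inj₂ (refl , p)) (inj₁ (q , _)) = ⊥-elim (G.~-irrefl q)
  irrelevant (inj₂ (_ , p))    (inj₂ (_ , q)) = D.irrelevant p q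

  out-injective : ∀ {x y z} (p : x ~ y) (q : x ~ z) → color p ≡ color q → y ≡ z
  out-injective (inj₁ (p , refl)) (inj₁ (q , refl)) eq =
    cong (_, _) (C.out-injective p q (P.injective _ eq))
  out-injective (inj₁ (p , _)) (inj₂ (_ , q)) eq = ⊥-elim (choose≢out _ q eq)
  out-injective (inj₂ (_ , p)) (inj₁ (q , _)) eq = ⊥-elim (choose≢out _ p (sym eq))
  out-injective (inj₂ (refl , p)) (inj₂ (refl , q)) eq = cong (_ ,_) (D.out-injective p q eq)

  through : ∀ {x y z} (p : x ~ y) (q : y ~ z) → color p ≢ color q
  -- Consecutive arcs along `G` stay over one vertex of `H`, so one injective palette renames both.
  -- In the mixed walks the palette avoids the out-colors when the `H`-arc comes second, and the
  -- entering color when it comes first.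
  through (inj₁ (p , refl)) (inj₁ (q , _)) eq = C.through p q (P.injective _ eq)
  through (inj₁ (p , refl)) (inj₂ (_ , q))    = choose≢out _ q
  through (inj₂ (_ , p))    (inj₁ (q , _))    = in≢choose p _
  through (inj₂ (_ , p))    (inj₂ (_ , q))    = D.through p q

-- Empty factors, arithmetic and conclusion.

empty-coloring : ∀ {G n} → ¬ Graph.Vertex G → ArcColoring G n
empty-coloring ¬v = record
  { color         = λ {u} _ → ⊥-elim (¬v u)
  ; irrelevant    = λ {u} _ → ⊥-elim (¬v u)
  ; out-injective = λ {u} _ → ⊥-elim (¬v u)
  ; through       = λ {u} _ → ⊥-elim (¬v u)
  }

vertex? : ∀ G → Dec (Graph.Vertex G)
vertex? G = map′ vertexAt index inhabited?
  where
  open Graph G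
  inhabited? : Dec (Fin order)
  inhabited? with order
  ... | zero  = no λ ()
  ... | suc _ = yes zero

-- The first bound leaves `g + 1` colors for `G` beside the `h + 1` forbidden ones; the second makes
-- room for the colors of `H′`. Truncated subtraction is harmless, as `h′` is at most `h + (h′ ∸ h)`
-- in every case.
fits : ∀ g h h′ {n} → g + h ≤ n → h′ ∸ h ≤ g + 1 → g + 1 + suc h ≤ n + 2 × h′ + 1 ≤ n + 2
fits g h h′ {n} g+h≤n h′∸h≤g+1 = palettes , colors
  where
  open ≤-Reasoning
  open +-*-Solver

  palettes : g + 1 + suc h ≤ n + 2
  palettes = begin
    g + 1 + suc h ≡⟨ solve 2 (λ g h → g :+ con 1 :+ (con 1 :+ h) := g :+ h :+ con 2) refl g h ⟩
    g + h + 2     ≤⟨ +-monoˡ-≤ 2 g+h≤n ⟩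
    n + 2         ∎

  colors : h′ + 1 ≤ n + 2
  colors = begin
    h′ + 1              ≤⟨ +-monoˡ-≤ 1 (m≤n+m∸n h′ h) ⟩
    h + (h′ ∸ h) + 1    ≤⟨ +-monoˡ-≤ 1 (+-monoʳ-≤ h h′∸h≤g+1) ⟩
    h + (g + 1) + 1     ≡⟨ solve 2 (λ g h → h :+ (g :+ con 1) :+ con 1 := g :+ con 1 :+ (con 1 :+ h)) refl g h ⟩
    g + 1 + suc h       ≤⟨ palettes ⟩
    n + 2               ∎

□-coloring-Δ+2 : ∀ {G H H′} → IsΔ+Graph 1 G → H ⊆ᴳ H′ → Regular H′ → IsΔ+Graph 1 H′ →
  Δ H′ ∸ Δ H ≤ Δ G + 1 → ArcColoring (G □ H) (Δ (G □ H) + 2)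
□-coloring-Δ+2 {G} {H} {H′} C H⊆H′ regular D Δ≤ = go (vertex? G) (vertex? H)
  where
  D′ : ArcColoring H′ (Δ H′ + 1)
  D′ = toArcColoring D

  D|H : ArcColoring H (Δ H′ + 1)
  D|H = restrict H⊆H′ D′

  D|H-mono : InMonochromatic D|H
  D|H-mono = restrict-inMonochromatic H⊆H′ {D′} (saturated⇒inMonochromatic D′
    (λ w → cong (_+ 1) (Degrees.regular⇒degree≡Δ H′ regular w)))

  go : Dec (Graph.Vertex G) → Dec (Graph.Vertex H) → ArcColoring (G □ H) (Δ (G □ H) + 2)
  go (no ¬u) _       = empty-coloring (¬u ∘ proj₁)
  go (yes _) (no ¬v) = empty-coloring (¬v ∘ proj₂)
  go (yes u) (yes v) = □-coloring (toArcColoring C) (weaken colors D|H)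
    (weaken-inMonochromatic colors {D|H} D|H-mono) palettes
    where
    fit      = fits (Δ G) (Δ H) (Δ H′) (Δ-□ G H u v) Δ≤
    palettes = proj₁ fit
    colors   = proj₂ fit

χᵢ≤ : ∀ {G n} → ArcColoring G n → χᵢ G ≤ n
χᵢ≤ {G} {n} C = proj₂ (proj₂ (leastColors G)) n (toIncidenceColoring C)

mainTheorem2 : (G H H′ : Graph) →
    IsΔ+Graph 1 G →
    H ⊆ᴳ H′ → Regular H′ → IsΔ+Graph 1 H′ →
    Δ G + 1 ≥ Δ H′ ∸ Δ H →
    χᵢ (G □ H) ≤ Δ (G □ H) + 2
mainTheorem2 G H H′ C H⊆H′ regular D Δ≥ =
  χᵢ≤ {G □ H} {Δ (G □ H) + 2} (□-coloring-Δ+2 C H⊆H′ regular D Δ≥)
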